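{- For all positive integers $n$ and $r$, $$\sum_{k=0}^{n}\frac{r}{k+r}\binom{n}{k}=\sum_{j=0}^{r-1}(-1)^{r-1-j}\,r\binom{r-1}{j}\left(\frac{2^{n+j+1}-1}{n+j+1}\right).$$
   Context: Here $\binom{n}{k}$ is the usual binomial coefficient; the identity is between rational numbers. The paper denotes the left-hand side by $S(n,r)$. -}

module Defs where

open import Algebra.Bundles using (CommutativeRing)
open import Data.Nat.Base using (ℕ; zero; suc; _+_; NonZero)
open import Data.Rational.Properties using (+-*-commutativeRing)

open CommutativeRing +-*-commutativeRing using (semiring)

open import Algebra.Properties.Semiring.Sum semiring public
  using (sum-syntax; sum⁺-syntax)
open import Algebra.Properties.Semiring.Exp semiring public
  using (_^_)

m+n≢0 : ∀ m n → .{{_ : NonZero n}} → NonZero (m + n)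
m+n≢0 zero    (suc _) = _
m+n≢0 (suc _) _       = _

{-# OPTIONS --safe #-}

-- Let T a n f = ∑ₖ aⁿ⁻ᵏ (n C k) f(k), the n-th power of the operator a + shift
-- applied to f. Since −1 + (1 + shift) = shift, applying T (−1) m in the variable n to
-- n ↦ T 1 n f gives back T 1 n of the m-fold shift of f. For f(k) = 1/(k+1) one has
-- T 1 n f = (2ⁿ⁺¹ − 1)/(n+1), and the lemma is r times this identity with m = r − 1.
module Submission where

open import Defs
open import Data.Fin.Base using (toℕ; fromℕ; inject₁)
open import Data.Fin.Properties using (toℕ-fromℕ; toℕ-inject₁; toℕ<n)
open import Data.Integer.Base as ℤ using (+_; 1ℤ)
import Data.Integer.Properties as ℤ
open import Data.Integer.Tactic.RingSolver using (solve-∀)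
open import Data.Nat.Base as ℕ using (ℕ; zero; suc; NonZero; _∸_)
open import Data.Nat.Combinatorics using (_C_; k>n⇒nCk≡0; nCk+nC[k+1]≡[n+1]C[k+1])
import Data.Nat.Properties as ℕ
import Data.Nat.Tactic.RingSolver as ℕ-Solver
open import Data.Rational.Base using (ℚ; _/_; _+_; _*_; -_; 0ℚ; 1ℚ; fromℚᵘ)
open import Data.Rational.Properties
open import Data.Rational.Solver using (module +-*-Solver)
open import Data.Rational.Unnormalised.Base as ℚᵘ using (mkℚᵘ; *≡*)
import Data.Rational.Unnormalised.Properties as ℚᵘ
open import Function.Base using (_∘_)
open import Algebra.Bundles using (CommutativeRing)
open import Algebra.Properties.Semiring.Sum (CommutativeRing.semiring +-*-commutativeRing)
  using (sum-cong-≗; sum-init-last; ∑-distrib-+; *-distribˡ-sum; *-distribʳ-sum)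
open import Relation.Binary.PropositionalEquality
open ≡-Reasoning

-- The absorption identity, by induction on `n` through Pascal's rule. The multiplied form keeps it
-- in ℕ, where no division has to be exact.
[1+k]*[1+n]C[1+k]≡[1+n]*nCk : ∀ n k → suc k ℕ.* (suc n C suc k) ≡ suc n ℕ.* (n C k)
[1+k]*[1+n]C[1+k]≡[1+n]*nCk zero    zero    = refl
[1+k]*[1+n]C[1+k]≡[1+n]*nCk zero    (suc k) = begin
  suc (suc k) ℕ.* (1 C suc (suc k))  ≡⟨ cong (suc (suc k) ℕ.*_) (k>n⇒nCk≡0 {1} {suc (suc k)} (ℕ.s<s ℕ.z<s)) ⟩
  suc (suc k) ℕ.* 0                  ≡⟨ ℕ.*-zeroʳ (suc (suc k)) ⟩
  0                                  ≡⟨ cong (1 ℕ.*_) (k>n⇒nCk≡0 {0} {suc k} ℕ.z<s) ⟨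
  1 ℕ.* (0 C suc k)                  ∎
[1+k]*[1+n]C[1+k]≡[1+n]*nCk (suc n) zero    = begin
  1 ℕ.* (suc (suc n) C 1)            ≡⟨ cong (1 ℕ.*_) (nCk+nC[k+1]≡[n+1]C[k+1] (suc n) 0) ⟨
  1 ℕ.* (1 ℕ.+ (suc n C 1))          ≡⟨ split (suc n C 1) ⟩
  1 ℕ.+ 1 ℕ.* (suc n C 1)            ≡⟨ cong (1 ℕ.+_) ([1+k]*[1+n]C[1+k]≡[1+n]*nCk n 0) ⟩
  1 ℕ.+ suc n ℕ.* 1                  ∎
  where
  split : ∀ c → 1 ℕ.* (1 ℕ.+ c) ≡ 1 ℕ.+ 1 ℕ.* c
  split = ℕ-Solver.solve-∀
[1+k]*[1+n]C[1+k]≡[1+n]*nCk (suc n) (suc k) = begin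
  suc (suc k) ℕ.* (suc (suc n) C suc (suc k))
    ≡⟨ cong (suc (suc k) ℕ.*_) (nCk+nC[k+1]≡[n+1]C[k+1] (suc n) (suc k)) ⟨
  -- One copy of `c` is set aside, so that the remaining coefficients `suc k` and `suc (suc k)` are
  -- those of the induction hypotheses at `k` and `suc k`. Pascal's rule then merges the two results
  -- into a multiple of `c`.
  suc (suc k) ℕ.* (c ℕ.+ (suc n C suc (suc k)))
    ≡⟨ split k c (suc n C suc (suc k)) ⟩
  c ℕ.+ (suc k ℕ.* c ℕ.+ suc (suc k) ℕ.* (suc n C suc (suc k)))
    ≡⟨ cong (c ℕ.+_) (cong₂ ℕ._+_ ([1+k]*[1+n]C[1+k]≡[1+n]*nCk n k) ([1+k]*[1+n]C[1+k]≡[1+n]*nCk n (suc k))) ⟩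
  c ℕ.+ (suc n ℕ.* (n C k) ℕ.+ suc n ℕ.* (n C suc k))
    ≡⟨ cong (c ℕ.+_) (ℕ.*-distribˡ-+ (suc n) (n C k) (n C suc k)) ⟨
  c ℕ.+ suc n ℕ.* ((n C k) ℕ.+ (n C suc k))
    ≡⟨ cong (λ x → c ℕ.+ suc n ℕ.* x) (nCk+nC[k+1]≡[n+1]C[k+1] n k) ⟩
  suc (suc n) ℕ.* c ∎
  where
  c = suc n C suc k
  split : ∀ k c d → suc (suc k) ℕ.* (c ℕ.+ d) ≡ c ℕ.+ (suc k ℕ.* c ℕ.+ suc (suc k) ℕ.* d)
  split = ℕ-Solver.solve-∀

-- Normalisation by the gcd blocks direct computation with `_/_`. Unnormalised fractions add by
-- formula, and equality of normalised ones can be tested there.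
fromℚᵘ-homo-+ : ∀ p q → fromℚᵘ (p ℚᵘ.+ q) ≡ fromℚᵘ p + fromℚᵘ q
fromℚᵘ-homo-+ p q = toℚᵘ-injective (ℚᵘ.≃-trans (toℚᵘ-fromℚᵘ (p ℚᵘ.+ q))
  (ℚᵘ.≃-sym (ℚᵘ.≃-trans (toℚᵘ-homo-+ (fromℚᵘ p) (fromℚᵘ q))
    (ℚᵘ.+-cong (toℚᵘ-fromℚᵘ p) (toℚᵘ-fromℚᵘ q)))))

fromℚᵘ-homo-* : ∀ p q → fromℚᵘ (p ℚᵘ.* q) ≡ fromℚᵘ p * fromℚᵘ q
fromℚᵘ-homo-* p q = toℚᵘ-injective (ℚᵘ.≃-trans (toℚᵘ-fromℚᵘ (p ℚᵘ.* q))
  (ℚᵘ.≃-sym (ℚᵘ.≃-trans (toℚᵘ-homo-* (fromℚᵘ p) (fromℚᵘ q))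
    (ℚᵘ.*-cong (toℚᵘ-fromℚᵘ p) (toℚᵘ-fromℚᵘ q)))))

/1-homo-+ : ∀ i j → (i ℤ.+ j) / 1 ≡ i / 1 + j / 1
/1-homo-+ i j = trans
  (fromℚᵘ-cong {mkℚᵘ (i ℤ.+ j) 0} {mkℚᵘ i 0 ℚᵘ.+ mkℚᵘ j 0} (*≡* (expand i j)))
  (fromℚᵘ-homo-+ (mkℚᵘ i 0) (mkℚᵘ j 0))
  where
  expand : ∀ i j → (i ℤ.+ j) ℤ.* 1ℤ ≡ (i ℤ.* 1ℤ ℤ.+ j ℤ.* 1ℤ) ℤ.* 1ℤ
  expand = solve-∀

/1-homo-* : ∀ i j → (i ℤ.* j) / 1 ≡ i / 1 * (j / 1)
/1-homo-* i j = fromℚᵘ-homo-* (mkℚᵘ i 0) (mkℚᵘ j 0)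

/1-homo-^ : ∀ i n → (i ℤ.^ n) / 1 ≡ (i / 1) ^ n
/1-homo-^ i zero    = refl
/1-homo-^ i (suc n) = trans (/1-homo-* i (i ℤ.^ n)) (cong (i / 1 *_) (/1-homo-^ i n))

-- Isolates the reciprocal, so that a ring solver can treat `1ℤ / d` as an atom.
i/d≡i/1*1/d : ∀ i d .{{_ : NonZero d}} → i / d ≡ i / 1 * (1ℤ / d)
i/d≡i/1*1/d i (suc d) = trans
  (fromℚᵘ-cong {mkℚᵘ i d} {mkℚᵘ i 0 ℚᵘ.* mkℚᵘ 1ℤ d} (*≡* (begin
    i ℤ.* + suc (d ℕ.+ 0)   ≡⟨ cong (λ e → i ℤ.* + suc e) (ℕ.+-identityʳ d) ⟩
    i ℤ.* + suc d           ≡⟨ cong (ℤ._* + suc d) (ℤ.*-identityʳ i) ⟨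
    i ℤ.* 1ℤ ℤ.* + suc d    ∎)))
  (fromℚᵘ-homo-* (mkℚᵘ i 0) (mkℚᵘ 1ℤ d))

-- Absorption in divided form: the denominator no longer depends on `k` and can be pulled out of a
-- sum over `k`.
nCk/[1+k]≡[1+n]C[1+k]/[1+n] : ∀ n k → + (n C k) / suc k ≡ + (suc n C suc k) / suc n
nCk/[1+k]≡[1+n]C[1+k]/[1+n] n k =
  fromℚᵘ-cong {mkℚᵘ (+ (n C k)) k} {mkℚᵘ (+ (suc n C suc k)) n} (*≡* (begin
    + (n C k) ℤ.* + suc n            ≡⟨ ℤ.pos-* (n C k) (suc n) ⟨
    + ((n C k) ℕ.* suc n)            ≡⟨ cong +_ (ℕ.*-comm (n C k) (suc n)) ⟩
    + (suc n ℕ.* (n C k))            ≡⟨ cong +_ ([1+k]*[1+n]C[1+k]≡[1+n]*nCk n k) ⟨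
    + (suc k ℕ.* (suc n C suc k))    ≡⟨ cong +_ (ℕ.*-comm (suc k) (suc n C suc k)) ⟩
    + ((suc n C suc k) ℕ.* suc k)    ≡⟨ ℤ.pos-* (suc n C suc k) (suc k) ⟩
    + (suc n C suc k) ℤ.* + suc k    ∎))

1^n≡1 : ∀ n → 1ℚ ^ n ≡ 1ℚ
1^n≡1 zero    = refl
1^n≡1 (suc n) = trans (*-identityˡ (1ℚ ^ n)) (1^n≡1 n)

T : ℚ → ℕ → (ℕ → ℚ) → ℚ
T a n f = ∑[ k ≤ n ] (a ^ (n ∸ toℕ k) * (+ (n C toℕ k) / 1) * f (toℕ k))

T-cong : ∀ a n {f g : ℕ → ℚ} → (∀ k → f k ≡ g k) → T a n f ≡ T a n g
T-cong a n f≗g = sum-cong-≗ {suc n} λ k →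
  cong (a ^ (n ∸ toℕ k) * (+ (n C toℕ k) / 1) *_) (f≗g (toℕ k))

-- One more factor of `a + shift`. Pascal's rule splits each summand with positive index into `u`,
-- which sums to the shifted part, and `v`, which together with the index 0 term `h` gives `a` times
-- the old sum.
T-suc : ∀ a n f → T a (suc n) f ≡ a * T a n f + T a n (f ∘ suc)
T-suc a n f = begin
  h + ∑[ k ≤ n ] (a ^ (n ∸ toℕ k) * (+ (suc n C suc (toℕ k)) / 1) * f (suc (toℕ k)))
    ≡⟨ cong (λ s → h + s) (sum-cong-≗ {suc n} (λ k → pascal (toℕ k))) ⟩
  h + ∑[ k ≤ n ] (u (toℕ k) + v (toℕ k))
    ≡⟨ cong (λ s → h + s) (∑-distrib-+ {suc n} (u ∘ toℕ) (v ∘ toℕ)) ⟩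
  h + (T a n (f ∘ suc) + ∑[ k ≤ n ] v (toℕ k))
    ≡⟨ cong (λ s → h + (T a n (f ∘ suc) + s)) (sum-init-last {n} (v ∘ toℕ)) ⟩
  h + (T a n (f ∘ suc) + (∑[ k < n ] v (toℕ (inject₁ k)) + v (toℕ (fromℕ n))))
    ≡⟨ cong₂ (λ s t → h + (T a n (f ∘ suc) + (s + t))) (sum-cong-≗ {n} v-inject₁) v-last ⟩
  h + (T a n (f ∘ suc) + (∑[ k < n ] (a * w (toℕ k)) + 0ℚ))
    ≡⟨ cong (λ s → h + (T a n (f ∘ suc) + (s + 0ℚ))) (*-distribˡ-sum {n} a (w ∘ toℕ)) ⟨
  h + (T a n (f ∘ suc) + (a * (∑[ k < n ] w (toℕ k)) + 0ℚ))
    -- `T a n f` unfolds to its index 0 term plus the sum of `w`, since `w k` is its summand at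
    -- `suc k`.
    ≡⟨ regroup a (a ^ n) (f 0) (T a n (f ∘ suc)) (∑[ k < n ] w (toℕ k)) ⟩
  a * T a n f + T a n (f ∘ suc) ∎
  where
  open +-*-Solver
  h = a ^ suc n * 1ℚ * f 0
  u v w : ℕ → ℚ
  u k = a ^ (n ∸ k) * (+ (n C k) / 1) * f (suc k)
  v k = a ^ (n ∸ k) * (+ (n C suc k) / 1) * f (suc k)
  w k = a ^ (n ∸ suc k) * (+ (n C suc k) / 1) * f (suc k)
  pascal : ∀ k → a ^ (n ∸ k) * (+ (suc n C suc k) / 1) * f (suc k) ≡ u k + v k
  pascal k = begin
    a ^ (n ∸ k) * (+ (suc n C suc k) / 1) * f (suc k)
      ≡⟨ cong (λ c → a ^ (n ∸ k) * (+ c / 1) * f (suc k)) (nCk+nC[k+1]≡[n+1]C[k+1] n k) ⟨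
    a ^ (n ∸ k) * (+ ((n C k) ℕ.+ (n C suc k)) / 1) * f (suc k)
      ≡⟨ cong (λ c → a ^ (n ∸ k) * c * f (suc k)) (/1-homo-+ (+ (n C k)) (+ (n C suc k))) ⟩
    a ^ (n ∸ k) * (+ (n C k) / 1 + + (n C suc k) / 1) * f (suc k)
      ≡⟨ solve 4 (λ p c d x → p :* (c :+ d) :* x := p :* c :* x :+ p :* d :* x) refl
           (a ^ (n ∸ k)) (+ (n C k) / 1) (+ (n C suc k) / 1) (f (suc k)) ⟩
    u k + v k ∎
  v-inject₁ : ∀ k → v (toℕ (inject₁ k)) ≡ a * w (toℕ k)
  v-inject₁ k = begin
    v (toℕ (inject₁ k))
      ≡⟨ cong v (toℕ-inject₁ k) ⟩
    v (toℕ k)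
      -- Because `toℕ k < n`, truncated subtraction behaves: the exponent is one more than
      -- `n ∸ suc (toℕ k)`, which releases a factor `a`.
      ≡⟨ cong (λ e → a ^ e * c * x) (ℕ.+-∸-assoc 1 (toℕ<n k)) ⟩
    a * a ^ (n ∸ suc (toℕ k)) * c * x
      ≡⟨ solve 4 (λ a p c x → a :* p :* c :* x := a :* (p :* c :* x)) refl
           a (a ^ (n ∸ suc (toℕ k))) c x ⟩
    a * w (toℕ k) ∎
    where
    c = + (n C suc (toℕ k)) / 1
    x = f (suc (toℕ k))
  v-last : v (toℕ (fromℕ n)) ≡ 0ℚ
  v-last = begin
    v (toℕ (fromℕ n))
      ≡⟨ cong v (toℕ-fromℕ n) ⟩
    v n
      ≡⟨ cong (λ c → a ^ (n ∸ n) * (+ c / 1) * f (suc n)) (k>n⇒nCk≡0 (ℕ.n<1+n n)) ⟩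
    a ^ (n ∸ n) * 0ℚ * f (suc n)
      ≡⟨ solve 2 (λ p x → p :* con 0ℚ :* x := con 0ℚ) refl (a ^ (n ∸ n)) (f (suc n)) ⟩
    0ℚ ∎
  regroup : ∀ a p x t s → a * p * 1ℚ * x + (t + (a * s + 0ℚ)) ≡ a * (p * 1ℚ * x + s) + t
  regroup = solve 5 (λ a p x t s →
    a :* p :* con 1ℚ :* x :+ (t :+ (a :* s :+ con 0ℚ)) := a :* (p :* con 1ℚ :* x :+ s) :+ t) refl

-- Induction on `m` with `n` left free: after `T-suc`, the hypothesis is needed at both `n` and
-- `suc n`. Expanding the latter once more cancels the multiples of `a` and leaves a single extra
-- shift.
T-inverse : ∀ a m n f → T (- a) m (λ j → T a (n ℕ.+ j) f) ≡ T a n (λ k → f (m ℕ.+ k))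
T-inverse a zero n f = begin
  1ℚ * 1ℚ * T a (n ℕ.+ 0) f + 0ℚ  ≡⟨ +-identityʳ _ ⟩
  1ℚ * T a (n ℕ.+ 0) f            ≡⟨ *-identityˡ _ ⟩
  T a (n ℕ.+ 0) f                 ≡⟨ cong (λ e → T a e f) (ℕ.+-identityʳ n) ⟩
  T a n f                         ∎
T-inverse a (suc m) n f = begin
  T (- a) (suc m) (λ j → T a (n ℕ.+ j) f)
    ≡⟨ T-suc (- a) m (λ j → T a (n ℕ.+ j) f) ⟩
  - a * T (- a) m (λ j → T a (n ℕ.+ j) f) + T (- a) m (λ j → T a (n ℕ.+ suc j) f)
    ≡⟨ cong₂ (λ s t → - a * s + t) (T-inverse a m n f)
         (trans (T-cong (- a) m (λ j → cong (λ e → T a e f) (ℕ.+-suc n j))) (T-inverse a m (suc n) f)) ⟩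
  - a * T a n fₘ + T a (suc n) fₘ
    ≡⟨ cong (λ s → - a * T a n fₘ + s) (T-suc a n fₘ) ⟩
  - a * T a n fₘ + (a * T a n fₘ + T a n (fₘ ∘ suc))
    ≡⟨ solve 3 (λ a s t → :- a :* s :+ (a :* s :+ t) := t) refl a (T a n fₘ) (T a n (fₘ ∘ suc)) ⟩
  T a n (fₘ ∘ suc)
    ≡⟨ T-cong a n (λ k → cong f (ℕ.+-suc m k)) ⟩
  T a n (λ k → f (suc m ℕ.+ k)) ∎
  where
  open +-*-Solver
  fₘ : ℕ → ℚ
  fₘ k = f (m ℕ.+ k)

-- The shift fixes constants, so `1 + shift` doubles them.
T-const : ∀ n → T 1ℚ n (λ _ → 1ℚ) ≡ (+ 2 / 1) ^ n
T-const zero    = refl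
T-const (suc n) = begin
  T 1ℚ (suc n) (λ _ → 1ℚ)                          ≡⟨ T-suc 1ℚ n (λ _ → 1ℚ) ⟩
  1ℚ * T 1ℚ n (λ _ → 1ℚ) + T 1ℚ n (λ _ → 1ℚ)       ≡⟨ double (T 1ℚ n (λ _ → 1ℚ)) ⟩
  (+ 2 / 1) * T 1ℚ n (λ _ → 1ℚ)                    ≡⟨ cong (+ 2 / 1 *_) (T-const n) ⟩
  (+ 2 / 1) ^ suc n                                ∎
  where
  open +-*-Solver
  double : ∀ t → 1ℚ * t + t ≡ (+ 2 / 1) * t
  double = solve 1 (λ t → con 1ℚ :* t :+ t := con (+ 2 / 1) :* t) refl

1/[1+_] : ℕ → ℚ
1/[1+ k ] = 1ℤ / suc k

-- Absorption replaces row `n` over varying denominators by row `suc n` over the single denominator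
-- `suc n`. The entry at 0 of that row is missing, hence the subtracted 1.
T-1/[1+k] : ∀ n → T 1ℚ n 1/[1+_] ≡ (((+ 2) ℤ.^ suc n) ℤ.- 1ℤ) / suc n
T-1/[1+k] n = begin
  T 1ℚ n 1/[1+_]
    ≡⟨ sum-cong-≗ {suc n} (λ k → absorb (toℕ k)) ⟩
  ∑[ k ≤ n ] (c (toℕ k) * 1/[1+ n ])
    ≡⟨ *-distribʳ-sum {suc n} 1/[1+ n ] (c ∘ toℕ) ⟨
  (∑[ k ≤ n ] c (toℕ k)) * 1/[1+ n ]
    ≡⟨ cong (_* 1/[1+ n ]) rowSum ⟩
  (((+ 2) ℤ.^ suc n) ℤ.- 1ℤ) / 1 * 1/[1+ n ]
    ≡⟨ i/d≡i/1*1/d (((+ 2) ℤ.^ suc n) ℤ.- 1ℤ) (suc n) ⟨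
  (((+ 2) ℤ.^ suc n) ℤ.- 1ℤ) / suc n ∎
  where
  open +-*-Solver
  c : ℕ → ℚ
  c k = 1ℚ ^ (n ∸ k) * (+ (suc n C suc k) / 1) * 1ℚ
  absorb : ∀ k → 1ℚ ^ (n ∸ k) * (+ (n C k) / 1) * 1/[1+ k ] ≡ c k * 1/[1+ n ]
  absorb k = begin
    1ℚ ^ (n ∸ k) * (+ (n C k) / 1) * 1/[1+ k ]
      ≡⟨ *-assoc (1ℚ ^ (n ∸ k)) (+ (n C k) / 1) 1/[1+ k ] ⟩
    1ℚ ^ (n ∸ k) * (+ (n C k) / 1 * 1/[1+ k ])
      ≡⟨ cong (1ℚ ^ (n ∸ k) *_) (i/d≡i/1*1/d (+ (n C k)) (suc k)) ⟨
    1ℚ ^ (n ∸ k) * (+ (n C k) / suc k)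
      ≡⟨ cong (1ℚ ^ (n ∸ k) *_) (nCk/[1+k]≡[1+n]C[1+k]/[1+n] n k) ⟩
    1ℚ ^ (n ∸ k) * (+ (suc n C suc k) / suc n)
      ≡⟨ cong (1ℚ ^ (n ∸ k) *_) (i/d≡i/1*1/d (+ (suc n C suc k)) (suc n)) ⟩
    1ℚ ^ (n ∸ k) * (+ (suc n C suc k) / 1 * 1/[1+ n ])
      ≡⟨ solve 3 (λ p x y → p :* (x :* y) := p :* x :* con 1ℚ :* y) refl
           (1ℚ ^ (n ∸ k)) (+ (suc n C suc k) / 1) 1/[1+ n ] ⟩
    c k * 1/[1+ n ] ∎
  rowSum : (∑[ k ≤ n ] c (toℕ k)) ≡ (((+ 2) ℤ.^ suc n) ℤ.- 1ℤ) / 1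
  rowSum = begin
    s
      -- The missing entry is added and subtracted in the exact shape of the first summand of
      -- `T 1ℚ (suc n)`; the trailing factor `1ℚ` in `c` serves the same match.
      ≡⟨ solve 1 (λ s → s := con 1ℚ :* con 1ℚ :* con 1ℚ :+ s :+ con (- 1ℚ)) refl s ⟩
    1ℚ * 1ℚ * 1ℚ + s + - 1ℚ
      ≡⟨ cong (λ p → p * 1ℚ * 1ℚ + s + - 1ℚ) (1^n≡1 (suc n)) ⟨
    T 1ℚ (suc n) (λ _ → 1ℚ) + - 1ℚ
      ≡⟨ cong (_+ - 1ℚ) (T-const (suc n)) ⟩
    (+ 2 / 1) ^ suc n + - 1ℚ
      ≡⟨ cong (_+ - 1ℚ) (/1-homo-^ (+ 2) (suc n)) ⟨
    ((+ 2) ℤ.^ suc n) / 1 + - 1ℚ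
      ≡⟨ /1-homo-+ ((+ 2) ℤ.^ suc n) (ℤ.- 1ℤ) ⟨
    (((+ 2) ℤ.^ suc n) ℤ.- 1ℤ) / 1 ∎
    where s = ∑[ k ≤ n ] c (toℕ k)

lemma1 : ∀ (n r : ℕ) → .{{_ : NonZero n}} → .{{_ : NonZero r}} →
    ∑[ k ≤ n ] (let instance _ = m+n≢0 (toℕ k) r in (+ r / (toℕ k ℕ.+ r)) * (+ (n C toℕ k) / 1))
    ≡
    ∑[ j < r ] (let instance _ = m+n≢0 (n ℕ.+ toℕ j) 1 in (- 1ℚ) ^ (r ∸ 1 ∸ toℕ j) * (+ r / 1) * (+ ((r ∸ 1) C toℕ j) / 1)
    * (((+ 2) ℤ.^ (n ℕ.+ toℕ j ℕ.+ 1) ℤ.- 1ℤ) / (n ℕ.+ toℕ j ℕ.+ 1)))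
lemma1 n r@(suc m) = begin
  _
    ≡⟨ sum-cong-≗ {suc n} (λ k → left (toℕ k)) ⟩
  ∑[ k ≤ n ] (R * (1ℚ ^ (n ∸ toℕ k) * (+ (n C toℕ k) / 1) * 1/[1+ m ℕ.+ toℕ k ]))
    ≡⟨ *-distribˡ-sum {suc n} R (λ k → 1ℚ ^ (n ∸ toℕ k) * (+ (n C toℕ k) / 1) * 1/[1+ m ℕ.+ toℕ k ]) ⟨
  R * T 1ℚ n (λ k → 1/[1+ m ℕ.+ k ])
    -- The denominators `k + r` have become an `m`-fold shift of `1/[1+_]`, so the inversion is read
    -- from right to left.
    ≡⟨ cong (R *_) (T-inverse 1ℚ m n 1/[1+_]) ⟨
  R * T (- 1ℚ) m (λ j → T 1ℚ (n ℕ.+ j) 1/[1+_])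
    ≡⟨ *-distribˡ-sum {suc m} R (λ j → (- 1ℚ) ^ (m ∸ toℕ j) * (+ (m C toℕ j) / 1) * T 1ℚ (n ℕ.+ toℕ j) 1/[1+_]) ⟩
  ∑[ j < r ] (R * ((- 1ℚ) ^ (m ∸ toℕ j) * (+ (m C toℕ j) / 1) * T 1ℚ (n ℕ.+ toℕ j) 1/[1+_]))
    ≡⟨ sum-cong-≗ {suc m} (λ j → right (toℕ j)) ⟩
  _ ∎
  where
  open +-*-Solver
  R = + r / 1
  left : ∀ k → let instance _ = m+n≢0 k r in
    (+ r / (k ℕ.+ r)) * (+ (n C k) / 1) ≡ R * (1ℚ ^ (n ∸ k) * (+ (n C k) / 1) * 1/[1+ m ℕ.+ k ])
  left k = begin
    (+ r / (k ℕ.+ r)) * c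
      -- With `r = suc m` in front, the denominator computes to `suc (m + k)`, the one in
      -- `1/[1+ m ℕ.+ k ]`.
      ≡⟨ cong (_* c) (/-cong {+ r} refl (ℕ.+-comm k r)) ⟩
    (+ r / (r ℕ.+ k)) * c
      ≡⟨ cong (_* c) (i/d≡i/1*1/d (+ r) (r ℕ.+ k)) ⟩
    R * 1/[1+ m ℕ.+ k ] * c
      ≡⟨ solve 3 (λ x y z → x :* y :* z := x :* (con 1ℚ :* z :* y)) refl R 1/[1+ m ℕ.+ k ] c ⟩
    R * (1ℚ * c * 1/[1+ m ℕ.+ k ])
      ≡⟨ cong (λ p → R * (p * c * 1/[1+ m ℕ.+ k ])) (1^n≡1 (n ∸ k)) ⟨
    R * (1ℚ ^ (n ∸ k) * c * 1/[1+ m ℕ.+ k ]) ∎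
    where
    c = + (n C k) / 1
    instance _ = m+n≢0 k r
  right : ∀ j → let instance _ = m+n≢0 (n ℕ.+ j) 1 in
    R * ((- 1ℚ) ^ (m ∸ j) * (+ (m C j) / 1) * T 1ℚ (n ℕ.+ j) 1/[1+_])
    ≡ (- 1ℚ) ^ (m ∸ j) * R * (+ (m C j) / 1) * (((+ 2) ℤ.^ (n ℕ.+ j ℕ.+ 1) ℤ.- 1ℤ) / (n ℕ.+ j ℕ.+ 1))
  right j = begin
    R * (p * c * T 1ℚ (n ℕ.+ j) 1/[1+_])
      ≡⟨ solve 4 (λ R p c t → R :* (p :* c :* t) := p :* R :* c :* t) refl R p c (T 1ℚ (n ℕ.+ j) 1/[1+_]) ⟩
    p * R * c * T 1ℚ (n ℕ.+ j) 1/[1+_]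
      ≡⟨ cong (p * R * c *_) (T-1/[1+k] (n ℕ.+ j)) ⟩
    p * R * c * (((+ 2) ℤ.^ suc (n ℕ.+ j) ℤ.- 1ℤ) / suc (n ℕ.+ j))
      ≡⟨ cong (p * R * c *_) (/-cong (cong (λ e → (+ 2) ℤ.^ e ℤ.- 1ℤ) 1+e) 1+e) ⟩
    p * R * c * (((+ 2) ℤ.^ (n ℕ.+ j ℕ.+ 1) ℤ.- 1ℤ) / (n ℕ.+ j ℕ.+ 1)) ∎
    where
    p = (- 1ℚ) ^ (m ∸ j)
    c = + (m C j) / 1
    1+e : suc (n ℕ.+ j) ≡ n ℕ.+ j ℕ.+ 1
    1+e = ℕ.+-comm 1 (n ℕ.+ j)
    instance _ = m+n≢0 (n ℕ.+ j) 1
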